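{- There exists an infinite family of graphs $G$ (with $|V(G)|$ unbounded) such that the nondeterministic communication complexity of the clique vs. independent set problem on $G$ is at least $(2-o(1))\log_2|V(G)|$; that is, there are graphs $G_1,G_2,\dots$ with $|V(G_t)|\to\infty$ and a function $\varepsilon$ with $\varepsilon(t)\to0$ such that this complexity for $G_t$ is at least $(2-\varepsilon(t))\log_2|V(G_t)|$.
   Context: For a graph $G$, in the clique vs. independent set problem Alice receives a clique $C$ of $G$ and Bob receives an independent set $I$ of $G$ (so $|C\cap I|\le 1$), and they must decide whether $C\cap I=\emptyset$. The nondeterministic communication complexity here refers to certifying the disjoint case: it is (up to rounding) $\log_2$ of the minimum number of combinatorial rectangles $\mathcal{A}\times\mathcal{I}$ ($\mathcal{A}$ a set of cliques, $\mathcal{I}$ a set of independent sets, with $C\cap I=\emptyset$ for all $C\in\mathcal{A}, I\in\mathcal{I}$) needed to cover all pairs $(C,I)$ with $C\cap I=\emptyset$. -}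

module Defs where

open import Data.Nat using (ℕ; _≤_; _*_; _^_; _∸_; _<_)
open import Data.Bool using (Bool; true; false)
open import Data.Fin using (Fin)
open import Data.Fin.Subset using (Subset; _∈_; _∩_; Empty)
open import Data.List using (List)
open import Data.List.Relation.Unary.Any using (Any)
open import Data.Product using (_×_; Σ; ∃)
open import Relation.Binary.PropositionalEquality using (_≡_; _≢_)
open import Level using (suc; zero)

record Graph : Set where
  field
    size : ℕ
    adj  : Fin size → Fin size → Bool
    sym  : ∀ i j → adj i j ≡ adj j i
    irr  : ∀ i → adj i i ≡ false
open Graph public

IsClique : (G : Graph) → Subset (size G) → Set
IsClique G C = ∀ i j → i ∈ C → j ∈ C → i ≢ j → adj G i j ≡ true

IsIndep : (G : Graph) → Subset (size G) → Set
IsIndep G I = ∀ i j → i ∈ I → j ∈ I → i ≢ j → adj G i j ≡ false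

Disjoint : ∀ {n} → Subset n → Subset n → Set
Disjoint C I = Empty (C ∩ I)

record Rectangle (G : Graph) : Set₁ where
  field
    cliques  : Subset (size G) → Set
    indeps   : Subset (size G) → Set
    cl-ok    : ∀ C → cliques C → IsClique G C
    ind-ok   : ∀ I → indeps I → IsIndep G I
    disj-ok  : ∀ C I → cliques C → indeps I → Disjoint C I
open Rectangle public

Covers : (G : Graph) → List (Rectangle G) → Set₁
Covers G Rs = ∀ C I → IsClique G C → IsIndep G I → Disjoint C I →
  Any (λ R → cliques R C × indeps R I) Rs

-- "The nondeterministic CIS complexity of G is at least (2 - p/q) log₂ |V(G)|",
-- i.e. every cover by r rectangles has log₂ r ≥ (2 - p/q) log₂ n,
-- equivalently r ^ q ≥ n ^ (2q - p)  (for p ≤ 2q).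
CISLowerBound : (G : Graph) → (p q : ℕ) → Set₁
CISLowerBound G p q = ∀ (Rs : List (Rectangle G)) → Covers G Rs →
  size G ^ (2 * q ∸ p) ≤ Data.List.length Rs ^ q

{-# OPTIONS --safe #-}

-- The bound comes from a fooling set of size N^(2-o(1)) in a graph on N vertices.
-- Let k be given and m = 2k.  Inputs are u = (y , z) with y, z ∈ [m]^k, so there
-- are m^(2k) of them.  For i, j ∈ [k] consider the relations
--   Q_i (u , u') :  y, y' first differ at i, and not z_{≥i} <lex z'_{≥i};
--   A_j (u , u') :  z, z' first differ at j, where z_j < z'_j, and y_{>j} = y'_{>j}.
-- No pair satisfies two of them: for j < i, Q_i and A_j disagree on whether
-- y_i = y'_i, and for i ≤ j on whether z_{≥i} <lex z'_{≥i}.  No (u , u) satisfies any,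
-- while for u ≠ u' one of (u , u'), (u' , u) satisfies one.  Each relation depends on
-- only k + 1 entries of u.  The vertices of the graph are the pairs (relation,
-- revealed entries); u gives the clique of what u reveals and the independent
-- set of the vertices whose relation holds towards u.  These 2k · m^(k+1) = m^(k+2)
-- vertices carry m^(2k) pairwise fooling (clique , independent set) pairs.

module Submission where

open import Defs hiding (sym)
open import Data.Nat using (ℕ; suc; s≤s; z≤n; _≤_; _*_; _<_; _+_; _^_; _∸_)
import Data.Nat.Properties as ℕₚ
open import Data.Fin as Fin using (Fin; zero; suc; _↑ˡ_; _↑ʳ_; splitAt; join; combine; remQuot; finToFun; funToFin)
import Data.Fin.Properties as Fin
open import Data.Fin.Subset using (Subset; _∈_)
open import Data.Fin.Subset.Properties using (x∈p∩q⁺; x∈p∩q⁻)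
open import Data.List using (List; length; lookup)
open import Data.List.Relation.Unary.Any using (index)
open import Data.List.Relation.Unary.Any.Properties using (lookup-index)
open import Data.Product using (Σ; _×_; ∃; _,_; proj₁; proj₂)
open import Data.Sum using (_⊎_; inj₁; inj₂; [_,_]′)
open import Data.Vec using (tabulate)
open import Data.Vec.Properties using (lookup∘tabulate; lookup⇒[]=; []=⇒lookup)
open import Function using (_∘_; mk⇔)
open import Relation.Binary using (tri<; tri≈; tri>)
open import Relation.Binary.PropositionalEquality using (_≡_; _≢_; refl; sym; trans; cong; cong₂; subst)
open import Relation.Nullary using (¬_; Dec; yes; no; does; contradiction)
open import Relation.Nullary.Decidable using (dec-true; dec-false; does-⇔; ¬?; _×-dec_; _→-dec_; decidable-stable)

-- Subsets given by decidable predicates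

module _ {n} {P : Fin n → Set} (P? : ∀ x → Dec (P x)) where

  ⟦_⟧ : Subset n
  ⟦_⟧ = tabulate (does ∘ P?)

  ∈⟦⟧⁺ : ∀ {x} → P x → x ∈ ⟦_⟧
  ∈⟦⟧⁺ {x} px = lookup⇒[]= x _ (trans (lookup∘tabulate _ x) (dec-true (P? x) px))

  ∈⟦⟧⁻ : ∀ {x} → x ∈ ⟦_⟧ → P x
  ∈⟦⟧⁻ {x} x∈ with P? x | trans (sym (lookup∘tabulate (does ∘ P?) x)) ([]=⇒lookup x∈)
  -- For `no` the second scrutinee would prove `false ≡ true`, so that case is absent.
  ... | yes px | _ = px

-- Fooling sets from unambiguous certificates

module Fooling {n T R : ℕ}
  (code   : Fin n → Fin T → Fin R)
  (Rel    : Fin T → Fin n → Fin n → Set)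
  (Rel?   : ∀ t u v → Dec (Rel t u v))
  (inv    : ∀ {t u u′ v} → code u t ≡ code u′ t → Rel t u v → Rel t u′ v)
  (irrefl : ∀ {t u} → ¬ Rel t u u)
  (unamb  : ∀ {t t′ u v} → Rel t u v → Rel t′ u v → t ≡ t′)
  (total  : ∀ {u v} → u ≢ v → ∃ λ t → Rel t u v ⊎ Rel t v u)
  where

  N : ℕ
  N = T * R

  tag : Fin N → Fin T
  tag x = proj₁ (remQuot R x)

  val : Fin N → Fin R
  val x = proj₂ (remQuot {T} R x)

  tag-val-injective : ∀ {x y} → tag x ≡ tag y → val x ≡ val y → x ≡ y
  tag-val-injective {x} {y} p q =
    trans (sym (Fin.combine-remQuot {T} R x)) (trans (cong₂ combine p q) (Fin.combine-remQuot {T} R y))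

  Left : Fin n → Fin N → Set
  Left u x = code u (tag x) ≡ val x

  -- A vertex is only a tag with a revealed value, hence the existential `u`; by `inv`, one witness
  -- `u` makes every input that reveals `x` related to `v`.
  Right : Fin n → Fin N → Set
  Right v x = ∃ λ u → Left u x × Rel (tag x) u v

  Left? : ∀ u x → Dec (Left u x)
  Left? u x = code u (tag x) Fin.≟ val x

  Right? : ∀ v x → Dec (Right v x)
  Right? v x = Fin.any? λ u → Left? u x ×-dec Rel? (tag x) u v

  meet⇒Rel : ∀ {u v x} → Left u x → Right v x → Rel (tag x) u v
  meet⇒Rel l (_ , l′ , r) = inv (trans l′ (sym l)) r

  Rel⇒meet : ∀ {t u v} → Rel t u v → ∃ λ x → Left u x × Right v x
  Rel⇒meet {t} {u} r = combine t (code u t) , left , u , left , subst (λ s → Rel s _ _) (sym tag≡) r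
    where
    eq = Fin.remQuot-combine t (code u t)
    tag≡ : tag (combine t (code u t)) ≡ t
    tag≡ = cong proj₁ eq
    left : Left u (combine t (code u t))
    left = trans (cong (code u) tag≡) (sym (cong proj₂ eq))

  -- Each meeting vertex gives a relation from `u` to `v`, so `unamb` equates the tags, and `u`
  -- reveals one value per tag.
  meet-unique : ∀ {u v x y} → Left u x → Left u y → Right v x → Right v y → x ≡ y
  meet-unique {u} lx ly rx ry = tag-val-injective t≡ (trans (sym lx) (trans (cong (code u) t≡) ly))
    where t≡ = unamb (meet⇒Rel lx rx) (meet⇒Rel ly ry)

  Adj : Fin N → Fin N → Set
  Adj x y = x ≢ y × ∃ λ u → Left u x × Left u y

  Adj? : ∀ x y → Dec (Adj x y)
  Adj? x y = ¬? (x Fin.≟ y) ×-dec Fin.any? λ u → Left? u x ×-dec Left? u y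

  Adj-sym : ∀ {x y} → Adj x y → Adj y x
  Adj-sym (x≢y , u , lx , ly) = x≢y ∘ sym , u , ly , lx

  G : Graph
  G = record
    { size = N
    ; adj  = λ x y → does (Adj? x y)
    ; sym  = λ x y → does-⇔ (mk⇔ Adj-sym Adj-sym) (Adj? x y) (Adj? y x)
    ; irr  = λ x → dec-false (Adj? x x) λ a → proj₁ a refl
    }

  C I : Fin n → Subset N
  C u = ⟦ Left? u ⟧
  I v = ⟦ Right? v ⟧

  C-clique : ∀ u → IsClique G (C u)
  C-clique u x y x∈ y∈ x≢y =
    dec-true (Adj? x y) (x≢y , u , ∈⟦⟧⁻ (Left? u) x∈ , ∈⟦⟧⁻ (Left? u) y∈)

  -- An edge inside `I v` would put two vertices of `I v` into one `C u`, against `meet-unique`.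
  I-indep : ∀ v → IsIndep G (I v)
  I-indep v x y x∈ y∈ x≢y = dec-false (Adj? x y) λ (_ , u , lx , ly) →
    x≢y (meet-unique lx ly (∈⟦⟧⁻ (Right? v) x∈) (∈⟦⟧⁻ (Right? v) y∈))

  Rel⇒¬Disjoint : ∀ {t u v} → Rel t u v → ¬ Disjoint (C u) (I v)
  Rel⇒¬Disjoint {u = u} {v} r d with x , lx , rx ← Rel⇒meet r =
    d (x , x∈p∩q⁺ (∈⟦⟧⁺ (Left? u) lx , ∈⟦⟧⁺ (Right? v) rx))

  C-I-disjoint : ∀ u → Disjoint (C u) (I u)
  C-I-disjoint u (x , x∈) with x∈C , x∈I ← x∈p∩q⁻ (C u) (I u) x∈ =
    irrefl (meet⇒Rel (∈⟦⟧⁻ (Left? u) x∈C) (∈⟦⟧⁻ (Right? u) x∈I))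

  cover-≥ : (Rs : List (Rectangle G)) → Covers G Rs → n ≤ length Rs
  cover-≥ Rs cov = Fin.injective⇒≤ {f = rect} rect-injective
    where
    covered = λ u → cov (C u) (I u) (C-clique u) (I-indep u) (C-I-disjoint u)

    rect : Fin n → Fin (length Rs)
    rect u = index (covered u)

    -- A rectangle shared by `u` and `v` also contains the crossed pair `C u`, `I v`, whose sets
    -- would then be disjoint.
    separated : ∀ {t u v} → rect u ≡ rect v → ¬ Rel t u v
    separated {u = u} {v} eq r = Rel⇒¬Disjoint r
      (disj-ok (lookup Rs (rect v)) _ _
        (subst (λ i → cliques (lookup Rs i) (C u)) eq (proj₁ (lookup-index (covered u))))
        (proj₂ (lookup-index (covered v))))

    rect-injective : ∀ {u v} → rect u ≡ rect v → u ≡ v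
    rect-injective {u} {v} eq = decidable-stable (u Fin.≟ v) λ u≢v →
      [ separated eq , separated (sym eq) ]′ (proj₂ (total u≢v))

-- Comparing words over an ordered alphabet

module _ {k m : ℕ} where

  Word : Set
  Word = Fin k → Fin m

  AgreeBefore : Fin k → Word → Word → Set
  AgreeBefore i p q = ∀ l → l Fin.< i → p l ≡ q l

  AgreeAfter : Fin k → Word → Word → Set
  AgreeAfter i p q = ∀ l → i Fin.< l → p l ≡ q l

  AgreeBetween : Fin k → Fin k → Word → Word → Set
  AgreeBetween i j p q = ∀ l → i Fin.≤ l → l Fin.< j → p l ≡ q l

  LexLessFrom : Fin k → Word → Word → Set
  LexLessFrom i p q = ∃ λ j → i Fin.≤ j × AgreeBetween i j p q × p j Fin.< q j

  agreeBefore? : ∀ i p q → Dec (AgreeBefore i p q)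
  agreeBefore? i p q = Fin.all? λ l → (l Fin.<? i) →-dec (p l Fin.≟ q l)

  agreeAfter? : ∀ i p q → Dec (AgreeAfter i p q)
  agreeAfter? i p q = Fin.all? λ l → (i Fin.<? l) →-dec (p l Fin.≟ q l)

  lexLessFrom? : ∀ i p q → Dec (LexLessFrom i p q)
  lexLessFrom? i p q = Fin.any? λ j → (i Fin.≤? j) ×-dec
    (Fin.all? λ l → (i Fin.≤? l) →-dec ((l Fin.<? j) →-dec (p l Fin.≟ q l))) ×-dec (p j Fin.<? q j)

  first-unique : ∀ {i j p q} → AgreeBefore i p q → p i ≢ q i → AgreeBefore j p q → p j ≢ q j → i ≡ j
  first-unique {i} {j} bi di bj dj with Fin.<-cmp i j
  ... | tri< i<j _ _ = contradiction (bj i i<j) di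
  ... | tri≈ _ i≡j _ = i≡j
  ... | tri> _ _ j<i = contradiction (bi j j<i) dj

  -- The earlier of the two deciding positions lies where the other comparison requires agreement.
  lexLessFrom-asym : ∀ {i p q} → LexLessFrom i p q → ¬ LexLessFrom i q p
  lexLessFrom-asym (j , i≤j , aj , lj) (j′ , i≤j′ , aj′ , lj′) with Fin.<-cmp j j′
  ... | tri< j<j′ _ _ = Fin.<⇒≢ lj (sym (aj′ j i≤j j<j′))
  ... | tri≈ _ refl _ = Fin.<-asym lj lj′
  ... | tri> _ _ j′<j = Fin.<⇒≢ lj′ (sym (aj j′ i≤j′ j′<j))

-- First differences and words coded as numbers

first-difference : ∀ {k m} (p q : Fin k → Fin m) →
  (∀ l → p l ≡ q l) ⊎ ∃ λ i → AgreeBefore i p q × p i ≢ q i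
first-difference {ℕ.zero} p q = inj₁ λ ()
first-difference {suc k} p q with p zero Fin.≟ q zero | first-difference (p ∘ suc) (q ∘ suc)
... | no  d | _                = inj₂ (zero , (λ _ ()) , d)
... | yes e | inj₁ es          = inj₁ λ { zero → e ; (suc l) → es l }
... | yes e | inj₂ (i , b , d) = inj₂ (suc i , (λ { zero _ → e ; (suc l) (s≤s l<i) → b l l<i }) , d)

funToFin-cong : ∀ {k m} {f g : Fin k → Fin m} → (∀ l → f l ≡ g l) → funToFin f ≡ funToFin g
funToFin-cong {ℕ.zero} eq = refl
funToFin-cong {suc k}  eq = cong₂ combine (eq zero) (funToFin-cong (eq ∘ suc))

finToFun-injective : ∀ {k m} {u v : Fin (m ^ k)} → (∀ l → finToFun {m} {k} u l ≡ finToFun v l) → u ≡ v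
finToFun-injective {k} {m} {u} {v} eq =
  trans (sym (Fin.funToFin-finToFin {k} {m} u)) (trans (funToFin-cong eq) (Fin.funToFin-finToFin {k} {m} v))

-- Revealing p up to and including i, and q from i on

module _ {k m : ℕ} (i : Fin k) where

  splice : (p q : Fin k → Fin m) → Fin (suc k) → Fin m
  -- Both words are revealed at `i`: slot `suc i` holds `q i`, so `p i` takes the extra slot `zero`.
  splice p q zero = p i
  splice p q (suc l) with l Fin.<? i
  ... | yes _ = p l
  ... | no  _ = q l

  splice-before : ∀ {p q p′ q′} → (∀ l → splice p q l ≡ splice p′ q′ l) → AgreeBefore i p p′
  splice-before eq l l<i with l Fin.<? i | eq (suc l)
  ... | yes _   | e = e
  ... | no  l≮i | _ = contradiction l<i l≮i

  splice-from : ∀ {p q p′ q′} → (∀ l → splice p q l ≡ splice p′ q′ l) → ∀ l → i Fin.≤ l → q l ≡ q′ l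
  splice-from eq l i≤l with l Fin.<? i | eq (suc l)
  ... | yes l<i | _ = contradiction i≤l (ℕₚ.<⇒≱ l<i)
  ... | no  _   | e = e

-- The two families of relations and their certificates

module Construction (k m : ℕ) where

  n : ℕ
  n = m ^ (k + k)

  Y Z : Fin n → Fin k → Fin m
  Y u l = finToFun {m} {k + k} u (l ↑ˡ k)
  Z u l = finToFun {m} {k + k} u (k ↑ʳ l)

  YZ-injective : ∀ {u v} → (∀ l → Y u l ≡ Y v l) → (∀ l → Z u l ≡ Z v l) → u ≡ v
  YZ-injective {u} {v} y z = finToFun-injective {k + k} {m} λ l →
    subst (λ l → finToFun {m} {k + k} u l ≡ finToFun v l) (Fin.join-splitAt k k l) (at (splitAt k l))
    where
    at : ∀ s → finToFun {m} {k + k} u (join k k s) ≡ finToFun v (join k k s)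
    at (inj₁ l) = y l
    at (inj₂ l) = z l

  Q A : Fin k → Fin n → Fin n → Set
  Q i u v = AgreeBefore i (Y u) (Y v) × Y u i ≢ Y v i × ¬ LexLessFrom i (Z u) (Z v)
  A j u v = AgreeBefore j (Z u) (Z v) × Z u j Fin.< Z v j × AgreeAfter j (Y u) (Y v)

  Rel : Fin k ⊎ Fin k → Fin n → Fin n → Set
  Rel = [ Q , A ]′

  Rel? : ∀ t u v → Dec (Rel t u v)
  Rel? (inj₁ i) u v = agreeBefore? i (Y u) (Y v) ×-dec ¬? (Y u i Fin.≟ Y v i)
    ×-dec ¬? (lexLessFrom? i (Z u) (Z v))
  Rel? (inj₂ j) u v = agreeBefore? j (Z u) (Z v) ×-dec (Z u j Fin.<? Z v j)
    ×-dec agreeAfter? j (Y u) (Y v)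

  reveal : Fin n → Fin k ⊎ Fin k → Fin (suc k) → Fin m
  reveal u (inj₁ i) = splice i (Y u) (Z u)
  reveal u (inj₂ j) = splice j (Z u) (Y u)

  inv : ∀ t {u u′ v} → (∀ l → reveal u t l ≡ reveal u′ t l) → Rel t u v → Rel t u′ v
  inv (inj₁ i) {u} {u′} {v} eq (b , d , ¬lex) =
    (λ l l<i → trans (sym (splice-before i eq l l<i)) (b l l<i)) ,
    (λ e → d (trans (eq zero) e)) ,
    λ (j , i≤j , a , lt) → ¬lex (j , i≤j ,
      (λ l i≤l l<j → trans (splice-from i eq l i≤l) (a l i≤l l<j)) ,
      subst (Fin._< Z v j) (sym (splice-from i eq j i≤j)) lt)
  inv (inj₂ j) {u} {u′} {v} eq (b , lt , a) =
    (λ l l<j → trans (sym (splice-before j eq l l<j)) (b l l<j)) ,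
    subst (Fin._< Z v j) (eq zero) lt ,
    λ l j<l → trans (sym (splice-from j eq l (ℕₚ.<⇒≤ j<l))) (a l j<l)

  irrefl : ∀ t {u} → ¬ Rel t u u
  irrefl (inj₁ i) (_ , d , _)  = d refl
  irrefl (inj₂ j) (_ , lt , _) = Fin.<-irrefl refl lt

  Q-A-exclusive : ∀ {i j u v} → Q i u v → ¬ A j u v
  Q-A-exclusive {i} {j} (_ , d , ¬lex) (b , lt , a) with j Fin.<? i
  ... | yes j<i = d (a i j<i)
  -- Agreement before `j` restricts to the positions from `i` on, so `j` decides the lexicographic
  -- comparison.
  ... | no  j≮i = ¬lex (j , ℕₚ.≮⇒≥ j≮i , (λ l _ → b l) , lt)

  unamb : ∀ t t′ {u v} → Rel t u v → Rel t′ u v → t ≡ t′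
  unamb (inj₁ i) (inj₁ i′) (b , d , _) (b′ , d′ , _) = cong inj₁ (first-unique b d b′ d′)
  unamb (inj₁ i) (inj₂ j)  q a = contradiction a (Q-A-exclusive q)
  unamb (inj₂ j) (inj₁ i)  a q = contradiction a (Q-A-exclusive q)
  unamb (inj₂ j) (inj₂ j′) (b , l , _) (b′ , l′ , _) =
    cong inj₂ (first-unique b (Fin.<⇒≢ l) b′ (Fin.<⇒≢ l′))

  -- If the `Y` words differ, asymmetry of the lexicographic order leaves `Q` true in at least one
  -- direction; if they agree, the first difference of the `Z` words orients `A`.
  total : ∀ {u v} → u ≢ v → ∃ λ t → Rel t u v ⊎ Rel t v u
  total {u} {v} u≢v with first-difference (Y u) (Y v)
  ... | inj₂ (i , b , d) with lexLessFrom? i (Z u) (Z v)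
  ...   | no ¬lex = inj₁ i , inj₁ (b , d , ¬lex)
  ...   | yes lex = inj₁ i , inj₂ ((λ l l<i → sym (b l l<i)) , d ∘ sym , lexLessFrom-asym lex)
  total {u} {v} u≢v | inj₁ y with first-difference (Z u) (Z v)
  ... | inj₁ z = contradiction (YZ-injective y z) u≢v
  ... | inj₂ (j , b , d) with Fin.<-cmp (Z u j) (Z v j)
  ...   | tri< lt _ _ = inj₂ j , inj₁ (b , lt , λ l _ → y l)
  ...   | tri≈ _ e _  = contradiction e d
  ...   | tri> _ _ gt = inj₂ j , inj₂ ((λ l l<j → sym (b l l<j)) , gt , λ l _ → sym (y l))

  splitAt-injective : ∀ {t t′ : Fin (k + k)} → splitAt k t ≡ splitAt k t′ → t ≡ t′
  splitAt-injective {t} {t′} e =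
    trans (sym (Fin.join-splitAt k k t)) (trans (cong (join k k) e) (Fin.join-splitAt k k t′))

  code : Fin n → Fin (k + k) → Fin (m ^ suc k)
  code u t = funToFin (reveal u (splitAt k t))

  TagRel : Fin (k + k) → Fin n → Fin n → Set
  TagRel t = Rel (splitAt k t)

  code-inv : ∀ {t u u′ v} → code u t ≡ code u′ t → TagRel t u v → TagRel t u′ v
  code-inv {t} {u} {u′} e = inv (splitAt k t) λ l →
    trans (sym (Fin.finToFun-funToFin (reveal u (splitAt k t)) l))
      (trans (cong (λ c → finToFun {m} {suc k} c l) e) (Fin.finToFun-funToFin (reveal u′ (splitAt k t)) l))

  tag-irrefl : ∀ {t u} → ¬ TagRel t u u
  tag-irrefl {t} = irrefl (splitAt k t)

  tag-unamb : ∀ {t t′ u v} → TagRel t u v → TagRel t′ u v → t ≡ t′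
  tag-unamb {t} {t′} r r′ = splitAt-injective (unamb (splitAt k t) (splitAt k t′) r r′)

  tag-total : ∀ {u v} → u ≢ v → ∃ λ t → TagRel t u v ⊎ TagRel t v u
  tag-total u≢v with t , r ← total u≢v =
    join k k t , subst (λ s → Rel s _ _ ⊎ Rel s _ _) (sym (Fin.splitAt-join k k t)) r

  open Fooling code TagRel (λ t → Rel? (splitAt k t))
    code-inv tag-irrefl tag-unamb tag-total
    public using (G; cover-≥)

-- With m = 2k the number 2k of relations is absorbed as one more factor m.
graph : ℕ → Graph
graph t = Construction.G (suc t) (suc t + suc t)

-- With `N = m ^ (k + 2)` vertices, the `m ^ (2k)` fooling pairs number `N` to the power
-- `2k / (k + 2) = 2 - 4 / (k + 2)`, whence `p = 4` and `q = k + 2`.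
graph-bound : ∀ t → CISLowerBound (graph t) 4 (suc t + 2)
graph-bound t Rs cov = begin
  (m ^ (2 + k)) ^ (2 * (k + 2) ∸ 4) ≡⟨ cong ((m ^ (2 + k)) ^_) exponent ⟩
  (m ^ (2 + k)) ^ (k + k)           ≡⟨ ℕₚ.^-*-assoc m (2 + k) (k + k) ⟩
  m ^ ((2 + k) * (k + k))           ≡⟨ cong (m ^_) (ℕₚ.*-comm (2 + k) (k + k)) ⟩
  m ^ ((k + k) * (2 + k))           ≡⟨ cong (λ e → m ^ ((k + k) * e)) (ℕₚ.+-comm 2 k) ⟩
  m ^ ((k + k) * (k + 2))           ≡⟨ ℕₚ.^-*-assoc m (k + k) (k + 2) ⟨
  (m ^ (k + k)) ^ (k + 2)           ≤⟨ ℕₚ.^-monoˡ-≤ (k + 2) (Construction.cover-≥ k m Rs cov) ⟩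
  length Rs ^ (k + 2)               ∎
  where
  open ℕₚ.≤-Reasoning
  k = suc t
  m = k + k
  exponent : 2 * (k + 2) ∸ 4 ≡ k + k
  exponent = trans (cong (_∸ 4) (ℕₚ.*-distribˡ-+ 2 k 2))
    (trans (ℕₚ.m+n∸n≡m (2 * k) 4) (cong (k +_) (ℕₚ.+-identityʳ k)))

graph-size : ∀ t → t ≤ size (graph t)
graph-size t = begin
  t                                           ≤⟨ ℕₚ.m≤n+m t 1 ⟩
  suc t                                       ≤⟨ ℕₚ.m≤m+n (suc t) (suc t) ⟩
  suc t + suc t                               ≤⟨ ℕₚ.m≤m*n (suc t + suc t) _ {{ℕₚ.m^n≢0 (suc t + suc t) (2 + t)}} ⟩
  (suc t + suc t) * (suc t + suc t) ^ (2 + t) ∎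
  where open ℕₚ.≤-Reasoning

theorem3 : Σ (ℕ → Graph) λ G → Σ (ℕ → ℕ) λ p → Σ (ℕ → ℕ) λ q →
    ((t : ℕ) → 0 < q t)
    × ((t : ℕ) → p t ≤ 2 * q t)
    × ((m : ℕ) → ∃ λ T → (t : ℕ) → T ≤ t → m ≤ size (G t))
    × ((k : ℕ) → ∃ λ T → (t : ℕ) → T ≤ t → k * p t ≤ q t)
    × ((t : ℕ) → CISLowerBound (G t) (p t) (q t))
theorem3 = graph , (λ _ → 4) , (λ t → suc t + 2)
  , (λ _ → s≤s z≤n)
  , (λ t → ℕₚ.*-monoʳ-≤ 2 (ℕₚ.m≤n+m 2 (suc t)))
  , (λ m → m , λ t m≤t → ℕₚ.≤-trans m≤t (graph-size t))
  -- Since `q t = t + 3` exceeds `t`, the threshold `k * 4` suffices for `p t / q t` to tend to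
  -- zero.
  , (λ k → k * 4 , λ t T≤t → ℕₚ.≤-trans T≤t (ℕₚ.≤-trans (ℕₚ.n≤1+n t) (ℕₚ.m≤m+n (suc t) 2)))
  , graph-bound
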